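{- Let $\mathbf{L}$ be an intermediate propositional logic and $\mathbf{QL}$ a first-order extension of $\mathbf{L}$ that is preserved under shadow. Then $\varepsilon\tau^+(\mathbf{QL})$ is conservative over $\mathbf{L}$ for propositional formulas: every propositional formula provable in $\varepsilon\tau^+(\mathbf{QL})$ belongs to $\mathbf{L}$.
   Context: An intermediate propositional logic is a set of propositional formulas containing intuitionistic propositional logic, contained in classical propositional logic, closed under modus ponens and substitution. Propositional variables are regarded as 0-ary predicate symbols of the first-order language. $\varepsilon\tau$-terms: for any formula $A(x)$, $\varepsilon x\,A(x)$ and $\tau x\,A(x)$ are terms. Critical formulas: $A(t)\to A(\varepsilon x\,A(x))$ and $A(\tau x\,A(x))\to A(t)$. $\varepsilon\tau^+(\mathbf{QL})$ is the full first-order language (with quantifiers) extended by $\varepsilon\tau$-terms, provability being derivability in $\mathbf{QL}$ (its axioms, modus ponens and quantifier rules) from critical formulas. Shadow: $P(t_1,\dots,t_n)^s=X_P$ (a propositional variable depending only on $P$), $(t_1=t_2)^s=\top$ (a theorem of $\mathbf{L}$), $^s$ commutes with $\land,\lor,\to,\lnot$, and $(\exists x\,A(x))^s=(\forall x\,A(x))^s=A(x)^s$. A first-order extension $\mathbf{QL}$ of $\mathbf{L}$ is preserved under shadow if (1) $\vdash_{\mathbf{L}}A^s$ for every quantifier axiom $A$ of $\mathbf{QL}$, and (2) whenever $A_1,\dots,A_n\vdash_{\mathbf{QL}}B$ is a rule of inference of $\mathbf{QL}$, $A_1^s,\dots,A_n^s\vdash_{\mathbf{L}}B^s$. -}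

module Defs where

open import Data.Nat using (ℕ; zero; suc)
open import Data.Vec using (Vec; []; _∷_)
open import Data.List using (List; []; _∷_; map)
open import Data.List.Membership.Propositional using (_∈_)
open import Data.List.Relation.Unary.All using (All)
open import Function using (Injective; _∘_)
open import Level using (0ℓ)
open import Relation.Binary.PropositionalEquality using (_≡_)
open import Relation.Unary using (Pred; _⊆_; _∪_; ∅)

infixr 5 _⇒ᵖ_
infixr 6 _∨ᵖ_
infixr 7 _∧ᵖ_
infix  8 ¬ᵖ_

------------------------------------------------------------------------
-- Propositional logic

data PForm : Set where
  pvar : ℕ → PForm
  _∧ᵖ_ _∨ᵖ_ _⇒ᵖ_ : PForm → PForm → PForm
  ¬ᵖ_  : PForm → PForm

_[_]ᵖ : PForm → (ℕ → PForm) → PForm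
pvar p   [ σ ]ᵖ = σ p
(A ∧ᵖ B) [ σ ]ᵖ = (A [ σ ]ᵖ) ∧ᵖ (B [ σ ]ᵖ)
(A ∨ᵖ B) [ σ ]ᵖ = (A [ σ ]ᵖ) ∨ᵖ (B [ σ ]ᵖ)
(A ⇒ᵖ B) [ σ ]ᵖ = (A [ σ ]ᵖ) ⇒ᵖ (B [ σ ]ᵖ)
(¬ᵖ A)   [ σ ]ᵖ = ¬ᵖ (A [ σ ]ᵖ)

-- Closure of a set of formulas under modus ponens.
data MPClosure (Γ : Pred PForm 0ℓ) : Pred PForm 0ℓ where
  ax : ∀ {A} → Γ A → MPClosure Γ A
  mp : ∀ {A B} → MPClosure Γ (A ⇒ᵖ B) → MPClosure Γ A → MPClosure Γ B

data IPCAxiom : Pred PForm 0ℓ where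
  K   : ∀ A B   → IPCAxiom (A ⇒ᵖ B ⇒ᵖ A)
  S   : ∀ A B C → IPCAxiom ((A ⇒ᵖ B ⇒ᵖ C) ⇒ᵖ (A ⇒ᵖ B) ⇒ᵖ A ⇒ᵖ C)
  ∧I  : ∀ A B   → IPCAxiom (A ⇒ᵖ B ⇒ᵖ A ∧ᵖ B)
  ∧E₁ : ∀ A B   → IPCAxiom (A ∧ᵖ B ⇒ᵖ A)
  ∧E₂ : ∀ A B   → IPCAxiom (A ∧ᵖ B ⇒ᵖ B)
  ∨I₁ : ∀ A B   → IPCAxiom (A ⇒ᵖ A ∨ᵖ B)
  ∨I₂ : ∀ A B   → IPCAxiom (B ⇒ᵖ A ∨ᵖ B)
  ∨E  : ∀ A B C → IPCAxiom ((A ⇒ᵖ C) ⇒ᵖ (B ⇒ᵖ C) ⇒ᵖ A ∨ᵖ B ⇒ᵖ C)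
  ¬I  : ∀ A B   → IPCAxiom ((A ⇒ᵖ B) ⇒ᵖ (A ⇒ᵖ ¬ᵖ B) ⇒ᵖ ¬ᵖ A)
  ¬E  : ∀ A B   → IPCAxiom (¬ᵖ A ⇒ᵖ A ⇒ᵖ B)

data ExcludedMiddle : Pred PForm 0ℓ where
  em : ∀ A → ExcludedMiddle (A ∨ᵖ ¬ᵖ A)

IPC CPC : Pred PForm 0ℓ
IPC = MPClosure IPCAxiom
CPC = MPClosure (IPCAxiom ∪ ExcludedMiddle)

record IsIntermediateLogic (L : Pred PForm 0ℓ) : Set where
  field
    contains-IPC   : IPC ⊆ L
    contained-CPC  : L ⊆ CPC
    closed-mp      : ∀ {A B} → L (A ⇒ᵖ B) → L A → L B
    closed-subst   : ∀ {A} (σ : ℕ → PForm) → L A → L (A [ σ ]ᵖ)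

-- As ⊢[ L ] B : derivability of B in L from the premises As.  The premises
-- are not closed under substitution.
_⊢[_]_ : List PForm → Pred PForm 0ℓ → PForm → Set
As ⊢[ L ] B = MPClosure (L ∪ (_∈ As)) B

⊤ᵖ : PForm
⊤ᵖ = pvar 0 ⇒ᵖ pvar 0

------------------------------------------------------------------------
-- The first-order language with ετ-terms

record Signature : Set₁ where
  field
    Fun     : ℕ → Set
    Rel     : ℕ → Set
    -- propositional variables as 0-ary predicate symbols
    propVar : ℕ → Rel 0

module Language (Sg : Signature) where

  open Signature Sg

  infixr 5 _⇒_
  infixr 6 _∨_
  infixr 7 _∧_
  infix  8 ¬'_
  infix  9 _≐_

  -- Variables are de Bruijn indices: ε, τ, ∃' and ∀' bind index 0 of their
  -- body, and indices beyond the enclosing binders are free variables.  So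
  -- formulas are identified up to renaming of bound variables.
  data Term : Set
  data Form : Set

  data Term where
    var : ℕ → Term
    fun : ∀ {k} → Fun k → Vec Term k → Term
    ε τ : Form → Term

  data Form where
    rel : ∀ {k} → Rel k → Vec Term k → Form
    _≐_ : Term → Term → Form
    _∧_ _∨_ _⇒_ : Form → Form → Form
    ¬'_ : Form → Form
    ∃' ∀' : Form → Form

  liftʳ : (ℕ → ℕ) → ℕ → ℕ
  liftʳ ρ zero    = zero
  liftʳ ρ (suc n) = suc (ρ n)

  renT  : (ℕ → ℕ) → Term → Term
  renTs : ∀ {k} → (ℕ → ℕ) → Vec Term k → Vec Term k
  renF  : (ℕ → ℕ) → Form → Form

  renT ρ (var n)    = var (ρ n)
  renT ρ (fun f ts) = fun f (renTs ρ ts)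
  renT ρ (ε A)      = ε (renF (liftʳ ρ) A)
  renT ρ (τ A)      = τ (renF (liftʳ ρ) A)

  renTs ρ []       = []
  renTs ρ (t ∷ ts) = renT ρ t ∷ renTs ρ ts

  renF ρ (rel P ts) = rel P (renTs ρ ts)
  renF ρ (t ≐ u)    = renT ρ t ≐ renT ρ u
  renF ρ (A ∧ B)    = renF ρ A ∧ renF ρ B
  renF ρ (A ∨ B)    = renF ρ A ∨ renF ρ B
  renF ρ (A ⇒ B)    = renF ρ A ⇒ renF ρ B
  renF ρ (¬' A)     = ¬' renF ρ A
  renF ρ (∃' A)     = ∃' (renF (liftʳ ρ) A)
  renF ρ (∀' A)     = ∀' (renF (liftʳ ρ) A)

  liftˢ : (ℕ → Term) → ℕ → Term
  liftˢ θ zero    = var zero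
  liftˢ θ (suc n) = renT suc (θ n)

  subT  : (ℕ → Term) → Term → Term
  subTs : ∀ {k} → (ℕ → Term) → Vec Term k → Vec Term k
  subF  : (ℕ → Term) → Form → Form

  subT θ (var n)    = θ n
  subT θ (fun f ts) = fun f (subTs θ ts)
  subT θ (ε A)      = ε (subF (liftˢ θ) A)
  subT θ (τ A)      = τ (subF (liftˢ θ) A)

  subTs θ []       = []
  subTs θ (t ∷ ts) = subT θ t ∷ subTs θ ts

  subF θ (rel P ts) = rel P (subTs θ ts)
  subF θ (t ≐ u)    = subT θ t ≐ subT θ u
  subF θ (A ∧ B)    = subF θ A ∧ subF θ B
  subF θ (A ∨ B)    = subF θ A ∨ subF θ B
  subF θ (A ⇒ B)    = subF θ A ⇒ subF θ B
  subF θ (¬' A)     = ¬' subF θ A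
  subF θ (∃' A)     = ∃' (subF (liftˢ θ) A)
  subF θ (∀' A)     = ∀' (subF (liftˢ θ) A)

  instantiate : Term → ℕ → Term
  instantiate t zero    = t
  instantiate t (suc n) = var n

  -- A(t), where A is the body of a binder.
  _[_] : Form → Term → Form
  A [ t ] = subF (instantiate t) A

  -- A in the scope of one further variable, which does not occur in it.
  wk : Form → Form
  wk = renF suc

  _⟪_⟫ : PForm → (ℕ → Form) → Form
  pvar p   ⟪ σ ⟫ = σ p
  (A ∧ᵖ B) ⟪ σ ⟫ = (A ⟪ σ ⟫) ∧ (B ⟪ σ ⟫)
  (A ∨ᵖ B) ⟪ σ ⟫ = (A ⟪ σ ⟫) ∨ (B ⟪ σ ⟫)
  (A ⇒ᵖ B) ⟪ σ ⟫ = (A ⟪ σ ⟫) ⇒ (B ⟪ σ ⟫)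
  (¬ᵖ A)   ⟪ σ ⟫ = ¬' (A ⟪ σ ⟫)

  ⌜_⌝ : PForm → Form
  ⌜ A ⌝ = A ⟪ (λ p → rel (propVar p) []) ⟫

  data Critical : Pred Form 0ℓ where
    ε-critical : ∀ A t → Critical (A [ t ] ⇒ A [ ε A ])
    τ-critical : ∀ A t → Critical (A [ τ A ] ⇒ A [ t ])

  ----------------------------------------------------------------------
  -- First-order extensions

  -- The axioms and rules peculiar to a first-order logic, beyond those of
  -- its propositional basis and modus ponens.  Each set consists of all
  -- instances of the schemata; as schemata, they have instances with
  -- ετ-terms.  Conditions on eigenvariables are part of the set of rules.
  record Calculus : Set₁ where
    field
      QAxiom : Pred Form 0ℓ
      QRule  : List Form → Form → Set

  open Calculus

  -- Provable L C Γ : derivability from Γ in the calculus whose axioms are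
  -- the first-order instances of members of L and the axioms of C, and whose
  -- rules are modus ponens and the rules of C.  Members of Γ are treated as
  -- axioms: no rule is restricted on account of variables free in Γ.
  data Provable (L : Pred PForm 0ℓ) (C : Calculus) (Γ : Pred Form 0ℓ) :
                Pred Form 0ℓ where
    prop-axiom : ∀ {A} (σ : ℕ → Form) → L A → Provable L C Γ (A ⟪ σ ⟫)
    q-axiom    : ∀ {A} → QAxiom C A → Provable L C Γ A
    hyp        : ∀ {A} → Γ A → Provable L C Γ A
    mp         : ∀ {A B} → Provable L C Γ (A ⇒ B) → Provable L C Γ A →
                 Provable L C Γ B
    q-rule     : ∀ {As B} → QRule C As B → All (Provable L C Γ) As →
                 Provable L C Γ B

  data StandardAxiom : Pred Form 0ℓ where
    ∀-elim  : ∀ A t → StandardAxiom (∀' A ⇒ A [ t ])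
    ∃-intro : ∀ A t → StandardAxiom (A [ t ] ⇒ ∃' A)

  data StandardRule : List Form → Form → Set where
    ∀-rule : ∀ A B → StandardRule ((wk B ⇒ A) ∷ []) (B ⇒ ∀' A)
    ∃-rule : ∀ A B → StandardRule ((A ⇒ wk B) ∷ []) (∃' A ⇒ B)

  standard : Calculus
  standard = record { QAxiom = StandardAxiom ; QRule = StandardRule }

  -- The theorems of QL include those of the least first-order extension of
  -- L, given by the usual quantifier axioms and rules.  Further quantifier
  -- principles (constant domains, quantifier shifts, axioms for identity, …)
  -- are allowed.
  record FirstOrderExtension (L : Pred PForm 0ℓ) : Set₁ where
    field
      calculus          : Calculus
      contains-standard : Provable L standard ∅ ⊆ Provable L calculus ∅

  -- ετ⁺(QL) ⊢ A
  ετ⁺-Provable : (L : Pred PForm 0ℓ) → FirstOrderExtension L → Pred Form 0ℓ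
  ετ⁺-Provable L QL =
    Provable L (FirstOrderExtension.calculus QL) Critical

  ----------------------------------------------------------------------
  -- Shadows

  -- The choice of the variables X_P.  Only distinctness of the variables
  -- chosen for propositional variables is required, so both the choice of
  -- pairwise distinct X_P and the choice with X_p = p are covered.
  record ShadowVariables : Set where
    field
      X          : ∀ {k} → Rel k → ℕ
      X-distinct : Injective _≡_ _≡_ (X ∘ propVar)

  module _ (V : ShadowVariables) where

    open ShadowVariables V

    shadow : Form → PForm
    shadow (rel P ts) = pvar (X P)
    shadow (t ≐ u)    = ⊤ᵖ
    shadow (A ∧ B)    = shadow A ∧ᵖ shadow B
    shadow (A ∨ B)    = shadow A ∨ᵖ shadow B
    shadow (A ⇒ B)    = shadow A ⇒ᵖ shadow B
    shadow (¬' A)     = ¬ᵖ shadow A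
    shadow (∃' A)     = shadow A
    shadow (∀' A)     = shadow A

    -- Modus ponens and the propositional axioms are not mentioned: for these
    -- the conditions hold in every intermediate logic.
    record PreservedUnderShadow (L : Pred PForm 0ℓ)
                                (QL : FirstOrderExtension L) : Set where
      open FirstOrderExtension QL
      field
        axioms : ∀ {A} → QAxiom calculus A → [] ⊢[ L ] shadow A
        rules  : ∀ {As B} → QRule calculus As B →
                 map shadow As ⊢[ L ] shadow B

{-# OPTIONS --safe #-}

-- The shadow of a formula does not depend on terms, so a critical formula has
-- a shadow of the form B → B, and the shadow of every derivation in ετ⁺(QL)
-- is a derivation in L.  The shadow of a propositional formula A is a
-- renaming of A that is injective on variables, and closure of L under
-- substitution undoes it.

module Submission where

open import Defs
open import Data.List using (map)
open import Data.List.Relation.Unary.All using (All; []; _∷_; lookup)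
open import Data.Nat using (ℕ; zero; suc; _⊔_; _≤_; _<_; _≟_)
open import Data.Nat.Properties
  using (≤-refl; m<1+n⇒m<n∨m≡n; m⊔n≤o⇒m≤o; m⊔n≤o⇒n≤o)
open import Data.Sum using (inj₁; inj₂)
open import Function using (Injective; _∘_)
open import Level using (0ℓ)
open import Relation.Binary.PropositionalEquality
  using (_≡_; refl; sym; trans; cong; cong₂; subst)
open import Relation.Nullary using (yes; no; contradiction)
open import Relation.Unary using (Pred)

-- The bound is strict: at `pvar p`, `varBound A ≤ n` unfolds to `p < n`.
varBound : PForm → ℕ
varBound (pvar p) = suc p
varBound (A ∧ᵖ B) = varBound A ⊔ varBound B
varBound (A ∨ᵖ B) = varBound A ⊔ varBound B
varBound (A ⇒ᵖ B) = varBound A ⊔ varBound B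
varBound (¬ᵖ A)   = varBound A

-- An injection ℕ → ℕ need not have a computable left inverse, but it has one
-- on its values at arguments below n.  Elsewhere the result is the junk value 0.
inverseBelow : (ℕ → ℕ) → ℕ → ℕ → ℕ
inverseBelow f zero    q = zero
inverseBelow f (suc n) q with f n ≟ q
... | yes _ = n
... | no  _ = inverseBelow f n q

inverseBelow-inverse : ∀ {f} → Injective _≡_ _≡_ f →
                       ∀ n {p} → p < n → inverseBelow f n (f p) ≡ p
inverseBelow-inverse {f} inj (suc n) {p} p<1+n with f n ≟ f p
-- The search returns the first hit `n`, a priori different from `p`; injectivity identifies the
-- two.
... | yes fn≡fp = inj fn≡fp
... | no  fn≢fp with m<1+n⇒m<n∨m≡n p<1+n
...   | inj₁ p<n  = inverseBelow-inverse inj n p<n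
...   | inj₂ refl = contradiction refl fn≢fp

-- The bound `n` is independent of `A`, so that one substitution serves all subformulas in the
-- induction.
rename-inverseBelow : ∀ {f} → Injective _≡_ _≡_ f →
  ∀ n A → varBound A ≤ n →
  (A [ pvar ∘ f ]ᵖ) [ pvar ∘ inverseBelow f n ]ᵖ ≡ A
rename-inverseBelow inj n (pvar p) p<n = cong pvar (inverseBelow-inverse inj n p<n)
rename-inverseBelow inj n (A ∧ᵖ B) b   = cong₂ _∧ᵖ_
  (rename-inverseBelow inj n A (m⊔n≤o⇒m≤o (varBound A) _ b))
  (rename-inverseBelow inj n B (m⊔n≤o⇒n≤o (varBound A) _ b))
rename-inverseBelow inj n (A ∨ᵖ B) b   = cong₂ _∨ᵖ_
  (rename-inverseBelow inj n A (m⊔n≤o⇒m≤o (varBound A) _ b))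
  (rename-inverseBelow inj n B (m⊔n≤o⇒n≤o (varBound A) _ b))
rename-inverseBelow inj n (A ⇒ᵖ B) b   = cong₂ _⇒ᵖ_
  (rename-inverseBelow inj n A (m⊔n≤o⇒m≤o (varBound A) _ b))
  (rename-inverseBelow inj n B (m⊔n≤o⇒n≤o (varBound A) _ b))
rename-inverseBelow inj n (¬ᵖ A) b     = cong ¬ᵖ_ (rename-inverseBelow inj n A b)

IPC-⇒-refl : ∀ A → IPC (A ⇒ᵖ A)
IPC-⇒-refl A = mp (mp (ax (S A (A ⇒ᵖ A) A)) (ax (K A (A ⇒ᵖ A)))) (ax (K A A))

module _ {L : Pred PForm 0ℓ} (isL : IsIntermediateLogic L) where

  open IsIntermediateLogic isL

  L-⇒-reflexive : ∀ {A B} → A ≡ B → L (A ⇒ᵖ B)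
  L-⇒-reflexive {A} refl = contains-IPC (IPC-⇒-refl A)

  -- Turns the two conditions of preservation under shadow into closure properties of `L`; closure
  -- under modus ponens suffices.
  ⊢-cut : ∀ {As B} → All L As → As ⊢[ L ] B → L B
  ⊢-cut As∈L (ax (inj₁ B∈L))  = B∈L
  ⊢-cut As∈L (ax (inj₂ B∈As)) = lookup As∈L B∈As
  ⊢-cut As∈L (mp d e)         = closed-mp (⊢-cut As∈L d) (⊢-cut As∈L e)

  rename-injective-reflects : ∀ {f} → Injective _≡_ _≡_ f →
                              ∀ A → L (A [ pvar ∘ f ]ᵖ) → L A
  rename-injective-reflects inj A A∈L =
    subst L (rename-inverseBelow inj (varBound A) A ≤-refl) (closed-subst _ A∈L)

module _ (Sg : Signature) (V : Language.ShadowVariables Sg) where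

  open Language Sg

  -- Substitution changes only terms, which the shadow discards. Quantifiers replace `θ` by
  -- `liftˢ θ`, so the induction needs every `θ`.
  shadow-subF : ∀ θ A → shadow V (subF θ A) ≡ shadow V A
  shadow-subF θ (rel P ts) = refl
  shadow-subF θ (t ≐ u)    = refl
  shadow-subF θ (A ∧ B)    = cong₂ _∧ᵖ_ (shadow-subF θ A) (shadow-subF θ B)
  shadow-subF θ (A ∨ B)    = cong₂ _∨ᵖ_ (shadow-subF θ A) (shadow-subF θ B)
  shadow-subF θ (A ⇒ B)    = cong₂ _⇒ᵖ_ (shadow-subF θ A) (shadow-subF θ B)
  shadow-subF θ (¬' A)     = cong ¬ᵖ_ (shadow-subF θ A)
  shadow-subF θ (∃' A)     = shadow-subF (liftˢ θ) A
  shadow-subF θ (∀' A)     = shadow-subF (liftˢ θ) A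

  shadow-instances : ∀ A t u → shadow V (A [ t ]) ≡ shadow V (A [ u ])
  shadow-instances A t u = trans (shadow-subF _ A) (sym (shadow-subF _ A))

  shadow-⟪⟫ : ∀ A σ → shadow V (A ⟪ σ ⟫) ≡ A [ shadow V ∘ σ ]ᵖ
  shadow-⟪⟫ (pvar p) σ = refl
  shadow-⟪⟫ (A ∧ᵖ B) σ = cong₂ _∧ᵖ_ (shadow-⟪⟫ A σ) (shadow-⟪⟫ B σ)
  shadow-⟪⟫ (A ∨ᵖ B) σ = cong₂ _∨ᵖ_ (shadow-⟪⟫ A σ) (shadow-⟪⟫ B σ)
  shadow-⟪⟫ (A ⇒ᵖ B) σ = cong₂ _⇒ᵖ_ (shadow-⟪⟫ A σ) (shadow-⟪⟫ B σ)
  shadow-⟪⟫ (¬ᵖ A)   σ = cong ¬ᵖ_ (shadow-⟪⟫ A σ)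

  module _ {L : Pred PForm 0ℓ} (isL : IsIntermediateLogic L)
           (QL : FirstOrderExtension L)
           (preserved : PreservedUnderShadow V L QL) where

    open IsIntermediateLogic isL
    open FirstOrderExtension QL
    open PreservedUnderShadow preserved

    shadow-critical : ∀ {A} → Critical A → L (shadow V A)
    shadow-critical (ε-critical A t) =
      L-⇒-reflexive isL (shadow-instances A t (ε A))
    shadow-critical (τ-critical A t) =
      L-⇒-reflexive isL (shadow-instances A (τ A) t)

    shadow-provable     : ∀ {A} → ετ⁺-Provable L QL A → L (shadow V A)
    -- Mutual recursion over the list of premises keeps the induction on derivations structural.
    shadow-all-provable : ∀ {As} → All (ετ⁺-Provable L QL) As →
                          All L (map (shadow V) As)

    -- The shadow of a first-order instance of `A` is the propositional instance under
    -- `shadow V ∘ σ`.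
    shadow-provable (prop-axiom {A} σ A∈L) =
      subst L (sym (shadow-⟪⟫ A σ)) (closed-subst _ A∈L)
    shadow-provable (q-axiom A∈Q) = ⊢-cut isL [] (axioms A∈Q)
    shadow-provable (hyp A∈Γ)     = shadow-critical A∈Γ
    shadow-provable (mp d e)      = closed-mp (shadow-provable d) (shadow-provable e)
    shadow-provable (q-rule r ds) = ⊢-cut isL (shadow-all-provable ds) (rules r)

    shadow-all-provable []       = []
    shadow-all-provable (d ∷ ds) = shadow-provable d ∷ shadow-all-provable ds

mainTheorem2 : (Sg : Signature) (let open Language Sg) (V : ShadowVariables)
    (L : Pred PForm 0ℓ) → IsIntermediateLogic L →
    (QL : FirstOrderExtension L) → PreservedUnderShadow V L QL →
    (A : PForm) → ετ⁺-Provable L QL ⌜ A ⌝ → L A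
mainTheorem2 Sg V L isL QL preserved A d =
  rename-injective-reflects isL (Language.ShadowVariables.X-distinct V) A
    -- For the `σ` that defines `⌜ A ⌝`, `shadow V ∘ σ` computes to `pvar ∘ X ∘ propVar`, a renaming
    -- that is injective by `X-distinct`.
    (subst L (shadow-⟪⟫ Sg V A _) (shadow-provable Sg V isL QL preserved d))
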